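{- For every integer $n\geqslant 5$, the graph $R_n''$ is $d$-balanced, i.e. $\gamma_{bd}(R_n'')=0$.
   Context: For a simple undirected finite graph $G$ and $v\in V(G)$, the closed neighborhood is $N_G[v]=\{u\in V(G): uv\in E(G)\}\cup\{v\}$. A function $f\colon V(G)\to\{ -1,0,1\}$ is a balanced domination function (BDF) on $G$ if $\sum_{u\in N_G[v]} f(u)=0$ for every $v\in V(G)$. Its weight is $\omega_f=\sum_{v\in V(G)} f(v)$. The balanced domination number $\gamma_{bd}(G)$ is the maximum of $\omega_f$ over all BDFs $f$ on $G$. The graph $G$ is called $d$-balanced if $\gamma_{bd}(G)=0$. For $n\geqslant 5$, the convex polytope graph $R_n''$ is the simple undirected graph with vertex set $V(R_n'')=\{u_i,v_i,w_i,p_i,q_i,r_i \mid 0\leqslant i\leqslant n-1\}$ ($6n$ distinct vertices) and edge set $E(R_n'')=\{u_iu_{i+1},\ r_ir_{i+1},\ u_iv_i,\ v_iw_i,\ w_ip_i,\ p_iq_i,\ q_ir_i,\ v_{i+1}w_i,\ p_iq_{i+1} \mid 0\leqslant i\leqslant n-1\}$, where indices are taken modulo $n$. -}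

module Defs where

open import Data.Empty using (⊥)
open import Data.Fin.Base using (Fin; toℕ)
open import Data.Fin.Patterns
import Data.Fin.Properties as Fin
open import Data.Integer.Base as ℤ using (ℤ; 0ℤ; 1ℤ; -1ℤ)
open import Data.List.Base using (List; []; _∷_; map; foldr; filter; allFin; cartesianProduct)
open import Data.List.Membership.Propositional using (_∈_)
open import Data.List.Membership.Propositional.Properties using (∈-allFin; ∈-cartesianProduct⁺)
import Data.List.Membership.DecPropositional as DecMembership
open import Data.List.Relation.Unary.Any using (here; there)
open import Data.List.Relation.Unary.Unique.Propositional using (Unique)
open import Data.List.Relation.Unary.Unique.Propositional.Properties using (allFin⁺; cartesianProduct⁺)
open import Data.Nat.Base as ℕ using (ℕ; suc; s≤s; z≤n; NonZero)
open import Data.Nat.DivMod using (_%_; _mod_; m%n<n; m<n⇒m%n≡m; n%n≡0)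
import Data.Nat.Properties as ℕ
open import Data.Product.Base using (_×_; _,_; proj₂; ∃-syntax)
open import Data.Product.Properties using (≡-dec)
open import Data.Sum.Base as Sum using (_⊎_; inj₁; inj₂)
open import Level using (0ℓ)
open import Relation.Binary.Core using (Rel)
open import Relation.Binary.Definitions using (Decidable; DecidableEquality; Symmetric)
open import Relation.Binary.PropositionalEquality using (_≡_; _≢_; refl; sym; trans; cong)
open import Relation.Nullary.Decidable using (_⊎-dec_)
open import Relation.Nullary.Negation using (¬_)

record FiniteSimpleGraph : Set₁ where
  infix 4 _~_ _~?_ _≟_
  field
    V        : Set
    vertices : List V
    complete : ∀ x → x ∈ vertices
    unique   : Unique vertices
    _≟_      : DecidableEquality V
    _~_      : Rel V 0ℓ
    _~?_     : Decidable _~_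
    ~-sym    : Symmetric _~_
    ~-irrefl : ∀ x → ¬ (x ~ x)

  N[_] : V → List V
  N[ x ] = filter (λ y → (y ~? x) ⊎-dec (y ≟ x)) vertices

data Value : Set where
  minus zero plus : Value

⟦_⟧ : Value → ℤ
⟦ minus ⟧ = -1ℤ
⟦ zero  ⟧ = 0ℤ
⟦ plus  ⟧ = 1ℤ

∑ : {A : Set} → List A → (A → Value) → ℤ
∑ xs f = foldr ℤ._+_ 0ℤ (map (λ x → ⟦ f x ⟧) xs)

module _ (G : FiniteSimpleGraph) where
  open FiniteSimpleGraph G

  IsBDF : (V → Value) → Set
  IsBDF f = ∀ x → ∑ N[ x ] f ≡ 0ℤ

  weight : (V → Value) → ℤ
  weight f = ∑ vertices f

  -- k is the maximum of the weights of all BDFs, i.e. γ_bd(G) = k.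
  IsBalancedDominationNumber : ℤ → Set
  IsBalancedDominationNumber k =
    (∃[ f ] (IsBDF f × weight f ≡ k)) × (∀ f → IsBDF f → weight f ℤ.≤ k)

  DBalanced : Set
  DBalanced = IsBalancedDominationNumber 0ℤ

infix 8 _+1

_+1 : ∀ {n} → Fin n → Fin n
_+1 {n} i = suc (toℕ i) mod n
  where instance
    n≢0 : NonZero n
    n≢0 = Fin.nonZeroIndex i

+1-≢ : ∀ {n} → 2 ℕ.≤ n → (i : Fin n) → i +1 ≢ i
+1-≢ {suc (suc m)} (s≤s (s≤s _)) i i+1≡i with ℕ.m≤n⇒m<n∨m≡n (Fin.toℕ<n i)
  | trans (sym (Fin.toℕ-fromℕ< (m%n<n (suc (toℕ i)) (suc (suc m))))) (cong toℕ i+1≡i)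
... | inj₁ i+1<n | i+1%n≡i = ℕ.1+n≢n (trans (sym (m<n⇒m%n≡m i+1<n)) i+1%n≡i)
... | inj₂ i+1≡n | i+1%n≡i = ℕ.0≢1+n (trans (sym (n%n≡0 (suc (suc m))))
  (trans (cong (_% suc (suc m)) (sym i+1≡n)) (trans i+1%n≡i (ℕ.suc-injective i+1≡n))))

Vertex : ℕ → Set
Vertex n = Fin 6 × Fin n

pattern u i = 0F , i
pattern v i = 1F , i
pattern w i = 2F , i
pattern p i = 3F , i
pattern q i = 4F , i
pattern r i = 5F , i

edgesAt : ∀ {n} → Fin n → List (Vertex n × Vertex n)
edgesAt i =
    (u i      , u (i +1))
  ∷ (r i      , r (i +1))
  ∷ (u i      , v i)
  ∷ (v i      , w i)
  ∷ (w i      , p i)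
  ∷ (p i      , q i)
  ∷ (q i      , r i)
  ∷ (v (i +1) , w i)
  ∷ (p i      , q (i +1))
  ∷ []

Edge : ∀ {n} → Rel (Vertex n) 0ℓ
Edge x y = ∃[ i ] (x , y) ∈ edgesAt i

vertex-≟ : ∀ {n} → DecidableEquality (Vertex n)
vertex-≟ = ≡-dec Fin._≟_ Fin._≟_

edge? : ∀ {n} → Decidable (Edge {n})
edge? x y = Fin.any? λ i → (x , y) ∈? edgesAt i
  where open DecMembership (≡-dec vertex-≟ vertex-≟) using (_∈?_)

edge-irrefl : ∀ {n} → 2 ℕ.≤ n → (x : Vertex n) → ¬ Edge x x
edge-irrefl 2≤n (l , j) (i , e) = go e refl refl
  where
  go : ∀ {x y} → (x , y) ∈ edgesAt i → x ≡ (l , j) → y ≡ (l , j) → ⊥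
  go (here refl) refl eq = +1-≢ 2≤n i (cong proj₂ eq)
  go (there (here refl)) refl eq = +1-≢ 2≤n i (cong proj₂ eq)
  go (there (there (here refl))) refl ()
  go (there (there (there (here refl)))) refl ()
  go (there (there (there (there (here refl))))) refl ()
  go (there (there (there (there (there (here refl)))))) refl ()
  go (there (there (there (there (there (there (here refl))))))) refl ()
  go (there (there (there (there (there (there (there (here refl)))))))) refl ()
  go (there (there (there (there (there (there (there (there (here refl))))))))) refl ()

R″ : (n : ℕ) → 5 ℕ.≤ n → FiniteSimpleGraph
R″ n 5≤n = record
  { V        = Vertex n
  ; vertices = cartesianProduct (allFin 6) (allFin n)
  ; complete = λ (l , i) → ∈-cartesianProduct⁺ (∈-allFin l) (∈-allFin i)
  ; unique   = cartesianProduct⁺ (allFin⁺ 6) (allFin⁺ n)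
  ; _≟_      = vertex-≟
  ; _~_      = λ x y → Edge x y ⊎ Edge y x
  ; _~?_     = λ x y → edge? x y ⊎-dec edge? y x
  ; ~-sym    = Sum.swap
  ; ~-irrefl = λ x → Sum.[ edge-irrefl 2≤n x , edge-irrefl 2≤n x ]
  }
  where
  2≤n : 2 ℕ.≤ n
  2≤n = ℕ.≤-trans (s≤s (s≤s z≤n)) 5≤n

{-# OPTIONS --safe #-}

-- R″ₙ is cubic, so every closed neighbourhood has four elements.  Summing f(N[x]) over all x
-- counts each f(y) once for every x ∈ N[y], hence 4 ω(f) = 0 for every BDF f.

module Submission where

open import Defs
open import Data.Nat.Base using (ℕ; _≤_; suc; s≤s; z≤n)
open import Data.Fin.Base using (Fin; zero; suc; toℕ; fromℕ; inject₁)
open import Data.Fin.Patterns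
import Data.Fin.Properties as Fin
open import Data.Fin.Relation.Unary.Top using (view; ‵fromℕ; ‵inject₁)
open import Data.Integer.Base as ℤ using (ℤ; +_; 0ℤ; _+_; _*_)
import Data.Integer.Properties as ℤ
open import Algebra.Bundles using (CommutativeMonoid)
open import Algebra.Properties.CommutativeSemigroup
  (CommutativeMonoid.commutativeSemigroup ℤ.+-0-commutativeMonoid) using (interchange; x∙yz≈y∙xz)
open import Data.List.Base using (List; []; _∷_; map; foldr; filter; length)
open import Data.List.Membership.Propositional using (_∈_)
open import Data.List.Membership.Propositional.Properties using (∈-filter⁺; ∈-filter⁻)
open import Data.List.Membership.Propositional.Properties.WithK using (unique⇒irrelevant)
open import Data.List.Properties using (filter-≐)
open import Data.List.Relation.Binary.BagAndSetEquality using (∼bag⇒↭)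
open import Data.List.Relation.Binary.Permutation.Propositional using (_↭_)
open import Data.List.Relation.Binary.Permutation.Propositional.Properties using (↭-length)
open import Data.List.Relation.Unary.All as All using (All; []; _∷_)
open import Data.List.Relation.Unary.AllPairs using ([]; _∷_)
open import Data.List.Relation.Unary.Any using (here; there)
open import Data.List.Relation.Unary.Unique.Propositional using (Unique)
open import Data.List.Relation.Unary.Unique.Propositional.Properties using (filter⁺)
open import Data.Nat.DivMod using (_%_; m%n<n; m<n⇒m%n≡m; n%n≡0)
import Data.Nat.Properties as ℕ
open import Data.Product.Base using (_,_; proj₂)
open import Data.Sum.Base as Sum using (_⊎_; inj₁; inj₂)
open import Function.Bundles using (mk↔ₛ′)
open import Level using (0ℓ)
open import Relation.Binary.Core using (REL)
open import Relation.Binary.Definitions using (Decidable)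
open import Relation.Binary.PropositionalEquality
  using (_≡_; _≢_; refl; sym; trans; cong; cong₂; subst; module ≡-Reasoning)
open import Relation.Nullary.Decidable using (yes; no; _⊎-dec_)

-- The argument works for every regular graph. If f is a BDF on a k-regular graph, adding up the
-- vanishing sums f(N[x]) over all x gives 0. By `double-counting`, the same total weights each f(y)
-- by the number of x with y in N[x], which is k + 1 by symmetry. Thus (k + 1) ω(f) = 0, hence ω(f)
-- = 0, and the zero function shows that 0 is attained: this is `regular⇒dBalanced`. What remains is
-- 3-regularity. Each N[x] is compared with the explicit four-element list `neighbourhood x`: the
-- two have the same members (`closed⇒∈`, `∈⇒closed`) and neither has repetitions, so they are
-- permutations of each other and have equal length.

-- Membership in a duplicate-free list has at most one proof, so the two inclusions are
-- automatically mutually inverse, which is bag equality.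
unique∧set⇒↭ : {A : Set} {xs ys : List A} → Unique xs → Unique ys →
               (∀ {x} → x ∈ xs → x ∈ ys) → (∀ {x} → x ∈ ys → x ∈ xs) → xs ↭ ys
unique∧set⇒↭ xs! ys! xs⊆ys ys⊆xs = ∼bag⇒↭
  (mk↔ₛ′ xs⊆ys ys⊆xs (λ _ → unique⇒irrelevant ys! _ _) (λ _ → unique⇒irrelevant xs! _ _))

-- Double counting over a decidable relation.

sum : {A : Set} → (A → ℤ) → List A → ℤ
sum g xs = foldr _+_ 0ℤ (map g xs)

sum-cong-≗ : {A : Set} {g h : A → ℤ} → (∀ x → g x ≡ h x) → ∀ xs → sum g xs ≡ sum h xs
sum-cong-≗ g≗h []       = refl
sum-cong-≗ g≗h (x ∷ xs) = cong₂ _+_ (g≗h x) (sum-cong-≗ g≗h xs)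

sum-zero : {A : Set} {g : A → ℤ} → (∀ x → g x ≡ 0ℤ) → ∀ xs → sum g xs ≡ 0ℤ
sum-zero g≗0 []       = refl
sum-zero g≗0 (x ∷ xs) = cong₂ _+_ (g≗0 x) (sum-zero g≗0 xs)

sum-*ˡ : {A : Set} (c : ℤ) (g : A → ℤ) → ∀ xs → sum (λ x → c * g x) xs ≡ c * sum g xs
sum-*ˡ c g []       = sym (ℤ.*-zeroʳ c)
sum-*ˡ c g (x ∷ xs) = trans (cong (_+_ (c * g x)) (sum-*ˡ c g xs))
                            (sym (ℤ.*-distribˡ-+ c (g x) (sum g xs)))

module _ {A B : Set} {R : REL A B 0ℓ} (R? : Decidable R) (g : B → ℤ) where

  private
    degree : List A → B → ℤ
    degree xs y = + length (filter (λ x → R? x y) xs)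

  -- Adding the row `x` to the incidence table raises the degree of `y` by one exactly when `R x y`
  -- holds, that is, when `y` survives the filter.
  sum-degree-∷ : ∀ x xs ys → sum g (filter (R? x) ys) + sum (λ y → degree xs y * g y) ys
                           ≡ sum (λ y → degree (x ∷ xs) y * g y) ys
  sum-degree-∷ x xs []       = refl
  sum-degree-∷ x xs (y ∷ ys) with ih ← sum-degree-∷ x xs ys | R? x y
  ... | yes _ = begin
    (g y + a) + (d * g y + b)  ≡⟨ interchange (g y) a (d * g y) b ⟩
    (g y + d * g y) + (a + b)  ≡⟨ cong₂ _+_ (sym (ℤ.suc-* d (g y))) ih ⟩
    ℤ.suc d * g y + c          ∎
    where
    open ≡-Reasoning
    a = sum g (filter (R? x) ys)
    d = degree xs y
    b = sum (λ z → degree xs z * g z) ys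
    c = sum (λ z → degree (x ∷ xs) z * g z) ys
  ... | no _ = trans
    (x∙yz≈y∙xz (sum g (filter (R? x) ys)) (degree xs y * g y) (sum (λ z → degree xs z * g z) ys))
    (cong (_+_ (degree xs y * g y)) ih)

  -- Both sides add `g y` over the related pairs, once by rows and once by columns.
  double-counting : ∀ xs ys → sum (λ x → sum g (filter (R? x) ys)) xs
                            ≡ sum (λ y → degree xs y * g y) ys
  double-counting []       ys = sym (sum-zero (λ y → ℤ.*-zeroˡ (g y)) ys)
  double-counting (x ∷ xs) ys =
    trans (cong (_+_ (sum g (filter (R? x) ys))) (double-counting xs ys)) (sum-degree-∷ x xs ys)

-- Regular graphs are d-balanced.

module _ (G : FiniteSimpleGraph) where
  open FiniteSimpleGraph G

  -- Here `k` is the degree; a closed neighbourhood has `suc k` elements, a visibly nonzero factor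
  -- that can be cancelled in the integers.
  regular⇒dBalanced : ∀ k → (∀ x → length N[ x ] ≡ suc k) → DBalanced G
  regular⇒dBalanced k regular =
    ((λ _ → zero) , (λ x → sum-zero (λ _ → refl) N[ x ]) , sum-zero (λ _ → refl) vertices) ,
    λ f bdf → ℤ.≤-reflexive (weight≡0 f bdf)
    where
    closed-sym : ∀ {x y} → y ~ x ⊎ y ≡ x → x ~ y ⊎ x ≡ y
    closed-sym = Sum.map ~-sym sym

    near? : Decidable (λ x y → y ~ x ⊎ y ≡ x)
    near? x y = (y ~? x) ⊎-dec (y ≟ x)

    degree : V → ℕ
    degree y = length (filter (λ x → near? x y) vertices)

    -- The column count tests `y ~ x` where `N[ y ]` tests `x ~ y`; symmetry identifies the two
    -- filters.
    degree≡1+k : ∀ y → degree y ≡ suc k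
    degree≡1+k y = trans
      (cong length (filter-≐ _ _ (closed-sym , closed-sym) vertices)) (regular y)

    weight≡0 : ∀ f → IsBDF G f → weight G f ≡ 0ℤ
    weight≡0 f bdf = ℤ.*-cancelˡ-≡ (+ suc k) (weight G f) 0ℤ (begin
      + suc k * weight G f                   ≡⟨ sum-*ˡ (+ suc k) g vertices ⟨
      sum (λ y → + suc k * g y) vertices     ≡⟨ sum-cong-≗ (λ y → cong (λ d → + d * g y) (degree≡1+k y))
                                                        vertices ⟨
      sum (λ y → + degree y * g y) vertices  ≡⟨ double-counting near? g vertices vertices ⟨
      sum (λ x → ∑ N[ x ] f) vertices        ≡⟨ sum-zero bdf vertices ⟩
      0ℤ                                     ≡⟨ ℤ.*-zeroʳ (+ suc k) ⟨
      + suc k * 0ℤ                           ∎)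
      where
      open ≡-Reasoning
      g : V → ℤ
      g y = ⟦ f y ⟧

-- Cyclic successor and predecessor.

-- Cyclic, unlike ℕ's _∸_: zero ∸1 is the last element.
infix 8 _∸1

_∸1 : ∀ {n} → Fin n → Fin n
_∸1 {suc n} zero    = fromℕ n
_∸1 {suc n} (suc i) = inject₁ i

fromℕ-+1 : ∀ n → fromℕ n +1 ≡ zero
fromℕ-+1 n = Fin.toℕ-injective (begin
  toℕ (fromℕ n +1)              ≡⟨ Fin.toℕ-fromℕ< (m%n<n (suc (toℕ (fromℕ n))) (suc n)) ⟩
  suc (toℕ (fromℕ n)) % suc n   ≡⟨ cong (λ k → suc k % suc n) (Fin.toℕ-fromℕ n) ⟩
  suc n % suc n                 ≡⟨ n%n≡0 (suc n) ⟩
  0                             ∎)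
  where
  open ≡-Reasoning

inject₁-+1 : ∀ {n} (i : Fin n) → inject₁ i +1 ≡ suc i
inject₁-+1 {n} i = Fin.toℕ-injective (begin
  toℕ (inject₁ i +1)              ≡⟨ Fin.toℕ-fromℕ< (m%n<n (suc (toℕ (inject₁ i))) (suc n)) ⟩
  suc (toℕ (inject₁ i)) % suc n   ≡⟨ cong (λ k → suc k % suc n) (Fin.toℕ-inject₁ i) ⟩
  suc (toℕ i) % suc n             ≡⟨ m<n⇒m%n≡m (s≤s (Fin.toℕ<n i)) ⟩
  suc (toℕ i)                     ∎)
  where
  open ≡-Reasoning

∸1-+1 : ∀ {n} (i : Fin n) → i ∸1 +1 ≡ i
∸1-+1 {suc n} zero    = fromℕ-+1 n
∸1-+1 {suc n} (suc i) = inject₁-+1 i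

-- The successor wraps around at the top element, so the cases are top and non-top instead of `zero`
-- and `suc`.
+1-∸1 : ∀ {n} (i : Fin n) → i +1 ∸1 ≡ i
+1-∸1 {suc n} i with view i
... | ‵fromℕ     = cong _∸1 (fromℕ-+1 n)
... | ‵inject₁ j = cong _∸1 (inject₁-+1 j)

∸1-≢ : ∀ {n} → 2 ≤ n → (i : Fin n) → i ∸1 ≢ i
∸1-≢ 2≤n i i∸1≡i = +1-≢ 2≤n i (trans (cong _+1 (sym i∸1≡i)) (∸1-+1 i))

-- On a cycle of length 2 the successor and predecessor coincide; from length 3 on they differ. At
-- either end of the range one of them wraps around and the constructors clash; in between their
-- values differ by 2.
+1-≢-∸1 : ∀ {n} → 3 ≤ n → (i : Fin n) → i +1 ≢ i ∸1
+1-≢-∸1 (s≤s (s≤s (s≤s _))) zero    eq with () ← trans (sym (inject₁-+1 0F)) eq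
+1-≢-∸1 (s≤s (s≤s (s≤s _))) (suc i) eq with view i
... | ‵fromℕ {n = suc n} with () ← trans (sym (fromℕ-+1 (suc (suc n)))) eq
... | ‵inject₁ j = ℕ.m≢1+n+m (toℕ j) {n = 1} (begin
  toℕ j                         ≡⟨ trans (Fin.toℕ-inject₁ (inject₁ j)) (Fin.toℕ-inject₁ j) ⟨
  toℕ (inject₁ (inject₁ j))     ≡⟨ cong toℕ (trans (sym eq) (inject₁-+1 (suc j))) ⟩
  suc (suc (toℕ j))             ∎)
  where open ≡-Reasoning

-- The closed neighbourhoods of the polytope graph.

neighbourhood : ∀ {n} → Vertex n → List (Vertex n)
neighbourhood (u i) = u i ∷ u (i +1) ∷ u (i ∸1) ∷ v i ∷ []
neighbourhood (v i) = v i ∷ u i ∷ w i ∷ w (i ∸1) ∷ []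
neighbourhood (w i) = w i ∷ v i ∷ v (i +1) ∷ p i ∷ []
neighbourhood (p i) = p i ∷ w i ∷ q i ∷ q (i +1) ∷ []
neighbourhood (q i) = q i ∷ p i ∷ p (i ∸1) ∷ r i ∷ []
neighbourhood (r i) = r i ∷ r (i +1) ∷ r (i ∸1) ∷ q i ∷ []

length-neighbourhood : ∀ {n} (x : Vertex n) → length (neighbourhood x) ≡ 4
length-neighbourhood (u i) = refl
length-neighbourhood (v i) = refl
length-neighbourhood (w i) = refl
length-neighbourhood (p i) = refl
length-neighbourhood (q i) = refl
length-neighbourhood (r i) = refl

-- Vertices in different layers differ by constructor. Within a layer the indices are among i, i + 1
-- and i - 1; all three occur only on the outer cycles `u` and `r`.
neighbourhood-unique : ∀ {n} → 3 ≤ n → (x : Vertex n) → Unique (neighbourhood x)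
neighbourhood-unique {n} 3≤n = λ where
    (u i) → (+1≢ i ∷ ∸1≢ i ∷ (λ ()) ∷ []) ∷ (+1≢∸1 i ∷ (λ ()) ∷ []) ∷ ((λ ()) ∷ []) ∷ [] ∷ []
    (v i) → ((λ ()) ∷ (λ ()) ∷ (λ ()) ∷ []) ∷ ((λ ()) ∷ (λ ()) ∷ []) ∷ (∸1≢ i ∷ []) ∷ [] ∷ []
    (w i) → ((λ ()) ∷ (λ ()) ∷ (λ ()) ∷ []) ∷ (+1≢ i ∷ (λ ()) ∷ []) ∷ ((λ ()) ∷ []) ∷ [] ∷ []
    (p i) → ((λ ()) ∷ (λ ()) ∷ (λ ()) ∷ []) ∷ ((λ ()) ∷ (λ ()) ∷ []) ∷ (+1≢ i ∷ []) ∷ [] ∷ []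
    (q i) → ((λ ()) ∷ (λ ()) ∷ (λ ()) ∷ []) ∷ (∸1≢ i ∷ (λ ()) ∷ []) ∷ ((λ ()) ∷ []) ∷ [] ∷ []
    (r i) → (+1≢ i ∷ ∸1≢ i ∷ (λ ()) ∷ []) ∷ (+1≢∸1 i ∷ (λ ()) ∷ []) ∷ ((λ ()) ∷ []) ∷ [] ∷ []
  where
  2≤n : 2 ≤ n
  2≤n = ℕ.≤-trans (s≤s (s≤s z≤n)) 3≤n

  +1≢ : ∀ {l : Fin 6} i → (l , i) ≢ (l , i +1)
  +1≢ i eq = +1-≢ 2≤n i (sym (cong proj₂ eq))

  ∸1≢ : ∀ {l : Fin 6} i → (l , i) ≢ (l , i ∸1)
  ∸1≢ i eq = ∸1-≢ 2≤n i (sym (cong proj₂ eq))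

  +1≢∸1 : ∀ {l : Fin 6} i → (l , i +1) ≢ (l , i ∸1)
  +1≢∸1 i eq = +1-≢-∸1 3≤n i (cong proj₂ eq)

-- Positions in a list: in `edgesAt` they name the nine edge families, in `neighbourhood` the four
-- entries.
pattern e₀ = here refl
pattern e₁ = there e₀
pattern e₂ = there e₁
pattern e₃ = there e₂
pattern e₄ = there e₃
pattern e₅ = there e₄
pattern e₆ = there e₅
pattern e₇ = there e₆
pattern e₈ = there e₇

module _ {n : ℕ} where

  -- The predicate by which `N[ x ]` filters the vertices of `R″`, unfolded.
  Closed : (y x : Vertex n) → Set
  Closed y x = (Edge y x ⊎ Edge x y) ⊎ y ≡ x

  edge⇒target∈ : {x y : Vertex n} → Edge x y → y ∈ neighbourhood x
  edge⇒target∈ (i , e₀) = e₁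
  edge⇒target∈ (i , e₁) = e₁
  edge⇒target∈ (i , e₂) = e₃
  edge⇒target∈ (i , e₃) = e₂
  edge⇒target∈ (i , e₄) = e₃
  edge⇒target∈ (i , e₅) = e₂
  edge⇒target∈ (i , e₆) = e₃
  -- The edge from v(i+1) to w(i): the list at v(i+1) contains w((i+1)-1), which equals w(i) only
  -- propositionally. The sources of `e₀`, `e₁` and `e₈` below need the same correction.
  edge⇒target∈ (i , e₇) = there (there (there (here (cong (2F ,_) (sym (+1-∸1 i))))))
  edge⇒target∈ (i , e₈) = e₃

  edge⇒source∈ : {x y : Vertex n} → Edge x y → x ∈ neighbourhood y
  edge⇒source∈ (i , e₀) = there (there (here (cong (0F ,_) (sym (+1-∸1 i)))))
  edge⇒source∈ (i , e₁) = there (there (here (cong (5F ,_) (sym (+1-∸1 i)))))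
  edge⇒source∈ (i , e₂) = e₁
  edge⇒source∈ (i , e₃) = e₁
  edge⇒source∈ (i , e₄) = e₁
  edge⇒source∈ (i , e₅) = e₁
  edge⇒source∈ (i , e₆) = e₃
  edge⇒source∈ (i , e₇) = e₂
  edge⇒source∈ (i , e₈) = there (there (here (cong (3F ,_) (sym (+1-∸1 i)))))

  self∈ : (x : Vertex n) → x ∈ neighbourhood x
  self∈ (u i) = here refl
  self∈ (v i) = here refl
  self∈ (w i) = here refl
  self∈ (p i) = here refl
  self∈ (q i) = here refl
  self∈ (r i) = here refl

  closed⇒∈ : {x y : Vertex n} → Closed y x → y ∈ neighbourhood x
  closed⇒∈ (inj₁ (inj₁ e)) = edge⇒source∈ e
  closed⇒∈ (inj₁ (inj₂ e)) = edge⇒target∈ e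
  closed⇒∈ (inj₂ refl)     = self∈ _

  neighbourhood-closed : (x : Vertex n) → All (λ y → Closed y x) (neighbourhood x)
  neighbourhood-closed = λ where
      (u i) → self ∷ out i e₀ ∷ before i e₀ ∷ out i e₂ ∷ []
      (v i) → self ∷ into i e₂ ∷ out i e₃ ∷ after i e₇ ∷ []
      (w i) → self ∷ into i e₃ ∷ into i e₇ ∷ out i e₄ ∷ []
      (p i) → self ∷ into i e₄ ∷ out i e₅ ∷ out i e₈ ∷ []
      (q i) → self ∷ into i e₅ ∷ before i e₈ ∷ out i e₆ ∷ []
      (r i) → self ∷ out i e₁ ∷ before i e₁ ∷ into i e₆ ∷ []
    where
    self : ∀ {x} → Closed x x
    self = inj₂ refl

    into : ∀ {x y} i → (y , x) ∈ edgesAt i → Closed y x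
    into i e = inj₁ (inj₁ (i , e))

    out : ∀ {x y} i → (x , y) ∈ edgesAt i → Closed y x
    out i e = inj₁ (inj₂ (i , e))

    -- An edge of the family at i - 1 meets index i as (i-1)+1, so it is transported along `∸1-+1`.
    -- In `before` that end is the target, in `after` the source.
    before : ∀ {y l} i → (y , (l , i ∸1 +1)) ∈ edgesAt (i ∸1) → Closed y (l , i)
    before {y} {l} i e = subst (λ j → Closed y (l , j)) (∸1-+1 i) (into (i ∸1) e)

    after : ∀ {y l} i → ((l , i ∸1 +1) , y) ∈ edgesAt (i ∸1) → Closed y (l , i)
    after {y} {l} i e = subst (λ j → Closed y (l , j)) (∸1-+1 i) (out (i ∸1) e)

  ∈⇒closed : {x y : Vertex n} → y ∈ neighbourhood x → Closed y x
  ∈⇒closed {x} = All.lookup (neighbourhood-closed x)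

theorem3 : (n : ℕ) (5≤n : 5 ≤ n) → DBalanced (R″ n 5≤n)
-- The graph is cubic: `suc 3` is the common length 4 of the explicit lists.
theorem3 n 5≤n = regular⇒dBalanced G 3 λ x → trans (↭-length (N↭ x)) (length-neighbourhood x)
  where
  G = R″ n 5≤n
  open FiniteSimpleGraph G

  3≤n : 3 ≤ n
  3≤n = ℕ.≤-trans (s≤s (s≤s (s≤s z≤n))) 5≤n

  N↭ : ∀ x → N[ x ] ↭ neighbourhood x
  N↭ x = unique∧set⇒↭ (filter⁺ near? unique) (neighbourhood-unique 3≤n x)
    (λ y∈N → closed⇒∈ (proj₂ (∈-filter⁻ near? {xs = vertices} y∈N)))
    (λ y∈  → ∈-filter⁺ near? (complete _) (∈⇒closed y∈))
    where near? = λ y → (y ~? x) ⊎-dec (y ≟ x)
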